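{- Let $(C,e,\lambda,\oplus)$ be the free Catalan structure, let $h\colon C\to C$ be the map defined in the context, and let $\mathrm{leaves},\mathrm{internal},\mathrm{sub},\mathrm{rpath}\colon C\to\mathbb{Z}_{\ge 0}$ be the four canonical statistics. For all $t\in C$ with $|t|\ge 1$, $$\mathrm{rpath}(h(t))=\mathrm{sub}(t)\quad\text{and}\quad \mathrm{leaves}(h(t))=\mathrm{internal}(t).$$ In particular, for every $n\ge 1$, the pairs $(\mathrm{sub},\mathrm{leaves})$ and $(\mathrm{rpath},\mathrm{internal})$ have the same joint distribution on $C_n$.
   Context: A Catalan structure is a quadruple $(C,e,\lambda,\oplus)$ where $C=\bigsqcup_{n\ge 0}C_n$ with $C_0=\{e\}$ (write $|t|=n$ for $t\in C_n$), $\lambda\colon C_n\to C_{n+1}$, $\oplus\colon C_m\times C_n\to C_{m+n}$, the operation $\oplus$ is associative with two-sided identity $e$, and every $t\in C$ can be written uniquely in exactly one of three forms: $t=e$; $t=\lambda(s)$ with $s\in C$ (indecomposable); $t=u\oplus v$ with $u$ indecomposable and $v\in C\setminus C_0$ (decomposable). Hence every nonempty $t$ is uniquely $\lambda(u)\oplus v$ (first-return decomposition, $v=e$ allowed). The free Catalan structure is the set of formal expressions $e$, $\lambda(t)$, and $\lambda(u)\oplus v$ with $v\ne e$, with the evident operations; it is isomorphic to rooted plane trees written as lists of children, with $e=[\,]$, $\lambda(T)=[T]$, $\oplus$ = concatenation of child lists, and size = number of edges. Derived operations: $\gamma(t)=t\oplus\lambda(e)$, and $\ominus$ is defined by $e\ominus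 v=v$, $\lambda(u)\ominus v=\lambda(u\ominus v)$, $(t\oplus u)\ominus v=t\oplus(u\ominus v)$ for $t,u\neq e$ (well defined; one may take $t$ indecomposable). The map $h$: $h(e)=e$ and $h(\lambda(u)\oplus v)=h(v)\ominus\gamma(h(u))$. Canonical statistics (in each clause for $u\oplus v$ both $u,v\ne e$): $\mathrm{leaves}(e)=1$, $\mathrm{leaves}(\lambda(t))=\mathrm{leaves}(t)$, $\mathrm{leaves}(u\oplus v)=\mathrm{leaves}(u)+\mathrm{leaves}(v)$; $\mathrm{internal}(e)=0$, $\mathrm{internal}(\lambda(t))=1+\mathrm{internal}(t)$, $\mathrm{internal}(u\oplus v)=\mathrm{internal}(u)+\mathrm{internal}(v)-1$; $\mathrm{sub}(e)=0$, $\mathrm{sub}(\lambda(t))=1$, $\mathrm{sub}(u\oplus v)=\mathrm{sub}(u)+\mathrm{sub}(v)$; $\mathrm{rpath}(e)=0$, $\mathrm{rpath}(\lambda(t))=1+\mathrm{rpath}(t)$, $\mathrm{rpath}(u\oplus v)=\mathrm{rpath}(v)$. -}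

module Defs where

open import Data.Nat using (ℕ; suc; _+_; _∸_; _≤_; z≤n; s≤s)
open import Data.Nat.Properties using (+-assoc; +-∸-assoc; ≤-trans; m≤n+m)
open import Data.Fin using (Fin)
open import Data.Product using (Σ-syntax; ∃-syntax; _×_; _,_)
open import Data.Empty using (⊥-elim)
open import Function.Bundles using (_↔_)
open import Relation.Binary.PropositionalEquality
  using (_≡_; _≢_; refl; sym; trans; cong)

infixr 6 λ⟨_⟩⊕_ _⊕_ _⊖_

-- The free Catalan structure.  A nonempty element is represented by its
-- first-return decomposition λ(u) ⊕ v.  The case v = e is allowed and encodes
-- the formal expression λ(u); for v ≠ e the constructor is the formal
-- expression λ(u) ⊕ v itself.  Read as plane trees: u is the first child of
-- the root and v carries the remaining children.
data C : Set where
  e      : C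
  λ⟨_⟩⊕_ : C → C → C

lam : C → C
lam t = λ⟨ t ⟩⊕ e

_⊕_ : C → C → C
e            ⊕ w = w
(λ⟨ u ⟩⊕ v)  ⊕ w = λ⟨ u ⟩⊕ (v ⊕ w)

size : C → ℕ
size e           = 0
size (λ⟨ u ⟩⊕ v) = suc (size u + size v)

γ : C → C
γ t = t ⊕ lam e

-- The third clause is (t ⊕ u) ⊖ w = t ⊕ (u ⊖ w) with t = λ(s) indecomposable;
-- the clause for arbitrary t, u ≠ e is ⊖-⊕ below.
_⊖_ : C → C → C
e                          ⊖ w = w
(λ⟨ u ⟩⊕ e)                ⊖ w = lam (u ⊖ w)
(λ⟨ s ⟩⊕ u@(λ⟨ _ ⟩⊕ _))    ⊖ w = lam s ⊕ (u ⊖ w)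

h : C → C
h e           = e
h (λ⟨ u ⟩⊕ v) = h v ⊖ γ (h u)

-- In each statistic the last clause is the rule for u ⊕ v with u = λ(s) and
-- v ≠ e, the value at λ(s) being written out; the rules for arbitrary
-- u, v ≠ e are leaves-⊕, internal-⊕, sub-⊕ and rpath-⊕ below.
leaves : C → ℕ
leaves e                         = 1
leaves (λ⟨ t ⟩⊕ e)               = leaves t
leaves (λ⟨ s ⟩⊕ v@(λ⟨ _ ⟩⊕ _))   = leaves s + leaves v

-- The truncated subtraction never truncates (internal-positive).
internal : C → ℕ
internal e                       = 0
internal (λ⟨ t ⟩⊕ e)             = 1 + internal t
internal (λ⟨ s ⟩⊕ v@(λ⟨ _ ⟩⊕ _)) = ((1 + internal s) + internal v) ∸ 1

sub : C → ℕ
sub e                            = 0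
sub (λ⟨ t ⟩⊕ e)                  = 1
sub (λ⟨ s ⟩⊕ v@(λ⟨ _ ⟩⊕ _))      = 1 + sub v

rpath : C → ℕ
rpath e                          = 0
rpath (λ⟨ t ⟩⊕ e)                = 1 + rpath t
rpath (λ⟨ s ⟩⊕ v@(λ⟨ _ ⟩⊕ _))    = rpath v

⊕-identityʳ : ∀ t → t ⊕ e ≡ t
⊕-identityʳ e           = refl
⊕-identityʳ (λ⟨ u ⟩⊕ v) = cong (λ⟨ u ⟩⊕_) (⊕-identityʳ v)

⊕-assoc : ∀ t u v → (t ⊕ u) ⊕ v ≡ t ⊕ (u ⊕ v)
⊕-assoc e             u v = refl
⊕-assoc (λ⟨ s ⟩⊕ t)   u v = cong (λ⟨ s ⟩⊕_) (⊕-assoc t u v)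

size-⊕ : ∀ u v → size (u ⊕ v) ≡ size u + size v
size-⊕ e           v = refl
size-⊕ (λ⟨ s ⟩⊕ u) v =
  cong suc (trans (cong (size s +_) (size-⊕ u v)) (sym (+-assoc (size s) _ _)))

⊖-⊕ : ∀ t u w → t ≢ e → u ≢ e → (t ⊕ u) ⊖ w ≡ t ⊕ (u ⊖ w)
⊖-⊕ e u w t≢e u≢e = ⊥-elim (t≢e refl)
⊖-⊕ t e w t≢e u≢e = ⊥-elim (u≢e refl)
⊖-⊕ (λ⟨ s ⟩⊕ e) (λ⟨ _ ⟩⊕ _) w _ _ = refl
⊖-⊕ (λ⟨ s ⟩⊕ t@(λ⟨ _ ⟩⊕ _)) u@(λ⟨ _ ⟩⊕ _) w _ u≢e =
  cong (λ⟨ s ⟩⊕_) (⊖-⊕ t u w (λ ()) u≢e)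

leaves-⊕ : ∀ u v → u ≢ e → v ≢ e → leaves (u ⊕ v) ≡ leaves u + leaves v
leaves-⊕ e v u≢e v≢e = ⊥-elim (u≢e refl)
leaves-⊕ u e u≢e v≢e = ⊥-elim (v≢e refl)
leaves-⊕ (λ⟨ s ⟩⊕ e) (λ⟨ _ ⟩⊕ _) _ _ = refl
leaves-⊕ (λ⟨ s ⟩⊕ u@(λ⟨ _ ⟩⊕ _)) v@(λ⟨ _ ⟩⊕ _) _ v≢e =
  trans (cong (leaves s +_) (leaves-⊕ u v (λ ()) v≢e))
        (sym (+-assoc (leaves s) _ _))

internal-positive : ∀ t → t ≢ e → 1 ≤ internal t
internal-positive e t≢e = ⊥-elim (t≢e refl)
internal-positive (λ⟨ t ⟩⊕ e) _ = s≤s z≤n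
internal-positive (λ⟨ s ⟩⊕ v@(λ⟨ _ ⟩⊕ _)) _ =
  ≤-trans (internal-positive v (λ ())) (m≤n+m _ (internal s))

internal-⊕ : ∀ u v → u ≢ e → v ≢ e →
             internal (u ⊕ v) ≡ (internal u + internal v) ∸ 1
internal-⊕ e v u≢e v≢e = ⊥-elim (u≢e refl)
internal-⊕ u e u≢e v≢e = ⊥-elim (v≢e refl)
internal-⊕ (λ⟨ s ⟩⊕ e) (λ⟨ _ ⟩⊕ _) _ _ = refl
internal-⊕ (λ⟨ s ⟩⊕ u@(λ⟨ _ ⟩⊕ _)) v@(λ⟨ _ ⟩⊕ _) _ v≢e =
  trans (cong (internal s +_) (internal-⊕ u v (λ ()) v≢e))
  (trans (sym (+-∸-assoc (internal s)
                (≤-trans (internal-positive v v≢e) (m≤n+m _ (internal u)))))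
         (cong (_∸ 1) (sym (+-assoc (internal s) _ _))))

sub-⊕ : ∀ u v → u ≢ e → v ≢ e → sub (u ⊕ v) ≡ sub u + sub v
sub-⊕ e v u≢e v≢e = ⊥-elim (u≢e refl)
sub-⊕ u e u≢e v≢e = ⊥-elim (v≢e refl)
sub-⊕ (λ⟨ s ⟩⊕ e) (λ⟨ _ ⟩⊕ _) _ _ = refl
sub-⊕ (λ⟨ s ⟩⊕ u@(λ⟨ _ ⟩⊕ _)) v@(λ⟨ _ ⟩⊕ _) _ v≢e =
  cong suc (sub-⊕ u v (λ ()) v≢e)

rpath-⊕ : ∀ u v → u ≢ e → v ≢ e → rpath (u ⊕ v) ≡ rpath v
rpath-⊕ e v u≢e v≢e = ⊥-elim (u≢e refl)
rpath-⊕ u e u≢e v≢e = ⊥-elim (v≢e refl)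
rpath-⊕ (λ⟨ s ⟩⊕ e) (λ⟨ _ ⟩⊕ _) _ _ = refl
rpath-⊕ (λ⟨ s ⟩⊕ u@(λ⟨ _ ⟩⊕ _)) v@(λ⟨ _ ⟩⊕ _) _ v≢e = rpath-⊕ u v (λ ()) v≢e

-- { t ∈ Cₙ : f(t) = a, g(t) = b }.  Equality in ℕ is proof-irrelevant, so the
-- elements of this type are exactly the elements t of that set.
Fiber : ℕ → (f g : C → ℕ) → ℕ → ℕ → Set
Fiber n f g a b = Σ[ t ∈ C ] (size t ≡ n × f t ≡ a × g t ≡ b)

HasCardinality : Set → ℕ → Set
HasCardinality A k = A ↔ Fin k

-- For all values (a , b), the pairs (f , g) and (f′ , g′) take that value on
-- the same finite number k of elements of Cₙ.
SameJointDistribution : ℕ → (f g f′ g′ : C → ℕ) → Set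
SameJointDistribution n f g f′ g′ =
  ∀ a b → ∃[ k ] (HasCardinality (Fiber n f g a b) k ×
                  HasCardinality (Fiber n f′ g′ a b) k)

{-# OPTIONS --safe #-}
-- Every nonempty tree is uniquely v ⊖ γ(u): u consists of the elder siblings
-- of the leaf ending the rightmost path.  The map h exchanges this last-leaf
-- decomposition with the first-return one, h(v ⊖ γ(u)) = λ(h(u)) ⊕ h(v), so h
-- is an involution.  Since rpath is additive along ⊖ and leaves is additive up
-- to the leaf that is replaced, rpath ∘ h = sub and leaves ∘ h = internal; by
-- involutivity also sub ∘ h = rpath, so h carries (rpath, internal) to
-- (sub, leaves).
module Submission where

open import Data.Nat using (ℕ; zero; suc; _+_; _≤_; z≤n; s≤s; _≟_)
open import Data.Nat.Properties
open import Data.Fin using (Fin; zero; suc)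
open import Data.Product using (Σ; _×_; _,_; proj₁; proj₂)
open import Data.List using (List; []; _∷_; length; lookup; filter; cartesianProductWith)
open import Data.List.Membership.Propositional using (_∈_)
open import Data.List.Membership.Propositional.Properties
  using (∈-lookup; ∈-filter⁺; ∈-filter⁻; ∈-cartesianProductWith⁺; ∈-cartesianProductWith⁻)
open import Data.List.Relation.Unary.All as All using (tabulate)
open import Data.List.Relation.Unary.AllPairs using ([]; _∷_)
open import Data.List.Relation.Unary.Any using (here; there; index)
open import Data.List.Relation.Unary.Any.Properties using (lookup-index)
open import Data.List.Relation.Unary.Unique.Propositional using (Unique)
import Data.List.Relation.Unary.Unique.Propositional.Properties as Unique
open import Function.Bundles using (_↔_; mk↔ₛ′)
open import Function.Construct.Composition using (_↔-∘_)
open import Relation.Nullary using (contradiction)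
open import Relation.Nullary.Decidable using (_×-dec_)
open import Relation.Unary using (Decidable; Irrelevant)
open import Relation.Binary.PropositionalEquality
  using (_≡_; _≢_; refl; sym; trans; cong; cong₂; module ≡-Reasoning)
open import Defs

⊖-≢e : ∀ v w → v ≢ e → v ⊖ w ≢ e
⊖-≢e e                        w v≢e _ = v≢e refl
⊖-≢e (λ⟨ _ ⟩⊕ e)              w _ ()
⊖-≢e (λ⟨ _ ⟩⊕ (λ⟨ _ ⟩⊕ _))    w _ ()

γ-≢e : ∀ u → γ u ≢ e
γ-≢e e           ()
γ-≢e (λ⟨ _ ⟩⊕ _) ()

h-≢e : ∀ u v → h (λ⟨ u ⟩⊕ v) ≢ e
h-≢e u e             = γ-≢e (h u)
h-≢e u (λ⟨ a ⟩⊕ b)   = ⊖-≢e (h (λ⟨ a ⟩⊕ b)) _ (h-≢e a b)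

-- The third clause of `⊖` computes only on a visible constructor; this form also serves at
-- `u = h v`, known merely to be nonempty.
lam-⊖ : ∀ s u w → u ≢ e → (λ⟨ s ⟩⊕ u) ⊖ w ≡ λ⟨ s ⟩⊕ (u ⊖ w)
lam-⊖ s u w u≢e = ⊖-⊕ (lam s) u w (λ ()) u≢e

-- Since `⊖` passes under `lam`, `lam (h b) ⊖ γ (h a)` reduces to `lam (h (λ⟨ a ⟩⊕ b))`, which
-- closes the induction along the children of the root.
h-γ : ∀ u → h (γ u) ≡ lam (h u)
h-γ e           = refl
h-γ (λ⟨ a ⟩⊕ b) = cong (_⊖ γ (h a)) (h-γ b)

h-⊖-γ : ∀ v u → h (v ⊖ γ u) ≡ λ⟨ h u ⟩⊕ h v
h-⊖-γ e                       u = h-γ u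
-- As `h (lam x)` reduces to `γ (h x)`, both sides are `γ` of the two sides of the equation for `a`.
h-⊖-γ (λ⟨ a ⟩⊕ e)             u = cong γ (h-⊖-γ a u)
h-⊖-γ (λ⟨ a ⟩⊕ v@(λ⟨ b ⟩⊕ c)) u = begin
  h (v ⊖ γ u) ⊖ γ (h a)        ≡⟨ cong (_⊖ γ (h a)) (h-⊖-γ v u) ⟩
  (λ⟨ h u ⟩⊕ h v) ⊖ γ (h a)    ≡⟨ lam-⊖ (h u) (h v) (γ (h a)) (h-≢e b c) ⟩
  λ⟨ h u ⟩⊕ (h v ⊖ γ (h a))    ∎
  where open ≡-Reasoning

h-involutive : ∀ t → h (h t) ≡ t
h-involutive e           = refl
h-involutive (λ⟨ u ⟩⊕ v) =
  trans (h-⊖-γ (h v) (h u)) (cong₂ λ⟨_⟩⊕_ (h-involutive u) (h-involutive v))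

size-⊖ : ∀ v w → size (v ⊖ w) ≡ size v + size w
size-⊖ e                         w = refl
size-⊖ (λ⟨ u ⟩⊕ e)               w = cong suc (begin
  size (u ⊖ w) + 0        ≡⟨ +-identityʳ _ ⟩
  size (u ⊖ w)            ≡⟨ size-⊖ u w ⟩
  size u + size w         ≡⟨ cong (_+ size w) (sym (+-identityʳ (size u))) ⟩
  size u + 0 + size w     ∎)
  where open ≡-Reasoning
size-⊖ (λ⟨ s ⟩⊕ u@(λ⟨ _ ⟩⊕ _))   w = cong suc
  (trans (cong (size s +_) (size-⊖ u w)) (sym (+-assoc (size s) _ _)))

size-h : ∀ t → size (h t) ≡ size t
size-h e           = refl
size-h (λ⟨ u ⟩⊕ v) = begin
  size (h v ⊖ γ (h u))            ≡⟨ size-⊖ (h v) (γ (h u)) ⟩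
  size (h v) + size (γ (h u))     ≡⟨ cong (size (h v) +_) (size-⊕ (h u) (lam e)) ⟩
  size (h v) + (size (h u) + 1)   ≡⟨ cong₂ (λ x y → x + (y + 1)) (size-h v) (size-h u) ⟩
  size v + (size u + 1)           ≡⟨ +-comm (size v) _ ⟩
  size u + 1 + size v             ≡⟨ cong (_+ size v) (+-comm (size u) 1) ⟩
  suc (size u + size v)           ∎
  where open ≡-Reasoning

-- The tree `w` is grafted onto the leaf ending the rightmost path of `v`, so its own rightmost path
-- prolongs that one.
rpath-⊖ : ∀ v w → rpath (v ⊖ w) ≡ rpath v + rpath w
rpath-⊖ e                       w = refl
rpath-⊖ (λ⟨ u ⟩⊕ e)             w = cong suc (rpath-⊖ u w)
rpath-⊖ (λ⟨ s ⟩⊕ u@(λ⟨ _ ⟩⊕ _)) w =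
  trans (rpath-⊕ (lam s) (u ⊖ w) (λ ()) (⊖-≢e u w λ ())) (rpath-⊖ u w)

rpath-γ : ∀ u → rpath (γ u) ≡ 1
rpath-γ e             = refl
rpath-γ u@(λ⟨ _ ⟩⊕ _) = rpath-⊕ u (lam e) (λ ()) (λ ())

sub-λ : ∀ u v → sub (λ⟨ u ⟩⊕ v) ≡ suc (sub v)
sub-λ u e           = refl
sub-λ u (λ⟨ _ ⟩⊕ _) = refl

rpath-h : ∀ t → rpath (h t) ≡ sub t
rpath-h e           = refl
rpath-h (λ⟨ u ⟩⊕ v) = begin
  rpath (h v ⊖ γ (h u))            ≡⟨ rpath-⊖ (h v) (γ (h u)) ⟩
  rpath (h v) + rpath (γ (h u))    ≡⟨ cong₂ _+_ (rpath-h v) (rpath-γ (h u)) ⟩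
  sub v + 1                        ≡⟨ +-comm (sub v) 1 ⟩
  suc (sub v)                      ≡⟨ sym (sub-λ u v) ⟩
  sub (λ⟨ u ⟩⊕ v)                  ∎
  where open ≡-Reasoning

sub-h : ∀ t → sub (h t) ≡ rpath t
sub-h t = trans (sym (rpath-h (h t))) (cong rpath (h-involutive t))

-- Grafting replaces one leaf of `v` by the leaves of `w`; the successor on the left avoids a
-- subtraction.
suc-leaves-⊖ : ∀ v w → suc (leaves (v ⊖ w)) ≡ leaves v + leaves w
suc-leaves-⊖ e                       w = refl
suc-leaves-⊖ (λ⟨ u ⟩⊕ e)             w = suc-leaves-⊖ u w
suc-leaves-⊖ (λ⟨ s ⟩⊕ u@(λ⟨ _ ⟩⊕ _)) w = begin
  suc (leaves (lam s ⊕ (u ⊖ w)))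
    ≡⟨ cong suc (leaves-⊕ (lam s) (u ⊖ w) (λ ()) (⊖-≢e u w λ ())) ⟩
  suc (leaves s + leaves (u ⊖ w))     ≡⟨ sym (+-suc (leaves s) _) ⟩
  leaves s + suc (leaves (u ⊖ w))     ≡⟨ cong (leaves s +_) (suc-leaves-⊖ u w) ⟩
  leaves s + (leaves u + leaves w)    ≡⟨ sym (+-assoc (leaves s) _ _) ⟩
  leaves s + leaves u + leaves w      ∎
  where open ≡-Reasoning

mutual
  leaves-h : ∀ t → t ≢ e → leaves (h t) ≡ internal t
  leaves-h e                         t≢e with () ← t≢e refl
  leaves-h (λ⟨ u ⟩⊕ e)               _ = leaves-γ-h u
  -- The `∸ 1` in `internal` cancels the 1 contributed by `lam u` by computation, so the goal is
  -- `internal u + internal v`.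
  leaves-h (λ⟨ u ⟩⊕ v@(λ⟨ _ ⟩⊕ _))   _ = suc-injective (begin
    suc (leaves (h v ⊖ γ (h u)))        ≡⟨ suc-leaves-⊖ (h v) (γ (h u)) ⟩
    leaves (h v) + leaves (γ (h u))     ≡⟨ cong₂ _+_ (leaves-h v λ ()) (leaves-γ-h u) ⟩
    internal v + suc (internal u)       ≡⟨ +-comm (internal v) _ ⟩
    suc (internal u + internal v)       ∎)
    where open ≡-Reasoning

  -- `γ` adds a leaf to a nonempty tree but keeps the count 1 at `e`. This offsets the failure of
  -- `leaves-h` at `e`, so an empty first subtree `u` is covered too.
  leaves-γ-h : ∀ u → leaves (γ (h u)) ≡ suc (internal u)
  leaves-γ-h e             = refl
  leaves-γ-h u@(λ⟨ a ⟩⊕ b) = begin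
    leaves (γ (h u))      ≡⟨ leaves-⊕ (h u) (lam e) (h-≢e a b) (λ ()) ⟩
    leaves (h u) + 1      ≡⟨ cong (_+ 1) (leaves-h u λ ()) ⟩
    internal u + 1        ≡⟨ +-comm (internal u) 1 ⟩
    suc (internal u)      ∎
    where open ≡-Reasoning

Σ-≡ : ∀ {A : Set} {P : A → Set} → Irrelevant P →
      {x y : Σ A P} → proj₁ x ≡ proj₁ y → x ≡ y
Σ-≡ irr {x , p} {_ , q} refl = cong (x ,_) (irr p q)

involution-↔ : ∀ {A : Set} {P Q : A → Set} → Irrelevant P → Irrelevant Q →
               (f : A → A) → (∀ x → f (f x) ≡ x) →
               (∀ {x} → P x → Q (f x)) → (∀ {x} → Q x → P (f x)) →
               Σ A P ↔ Σ A Q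
involution-↔ irrP irrQ f ff P⇒Q Q⇒P = mk↔ₛ′
  (λ (x , p) → f x , P⇒Q p) (λ (x , q) → f x , Q⇒P q)
  (λ (x , _) → Σ-≡ irrQ (ff x)) (λ (x , _) → Σ-≡ irrP (ff x))

lookup-injective : ∀ {A : Set} {xs : List A} → Unique xs →
                   ∀ i j → lookup xs i ≡ lookup xs j → i ≡ j
lookup-injective (_ ∷ _)       zero    zero    _  = refl
lookup-injective (x≢ ∷ _)      zero    (suc j) eq = contradiction eq (All.lookup x≢ (∈-lookup j))
lookup-injective (x≢ ∷ _)      (suc i) zero    eq =
  contradiction (sym eq) (All.lookup x≢ (∈-lookup i))
lookup-injective (_ ∷ unique)  (suc i) (suc j) eq = cong suc (lookup-injective unique i j eq)

-- Completeness gives each element a position in `xs`, uniqueness makes it the only one, and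
-- irrelevance reduces equality of pairs to their first components.
enumeration-↔ : ∀ {A : Set} {P : A → Set} → Irrelevant P →
                (xs : List A) → Unique xs →
                (∀ {x} → P x → x ∈ xs) → (∀ {x} → x ∈ xs → P x) →
                Σ A P ↔ Fin (length xs)
enumeration-↔ irr xs unique P⇒∈ ∈⇒P = mk↔ₛ′
  (λ (_ , p) → index (P⇒∈ p))
  (λ i → lookup xs i , ∈⇒P (∈-lookup i))
  (λ i → lookup-injective unique _ _ (sym (lookup-index (P⇒∈ (∈⇒P (∈-lookup i))))))
  (λ (_ , p) → Σ-≡ irr (sym (lookup-index (P⇒∈ p))))

-- With `e` read as an empty binary tree and `λ⟨_⟩⊕_` as a node, these are the trees of height at
-- most `n`. Trees larger than `n` occur too and are filtered out in `fiber-↔`.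
trees : ℕ → List C
trees zero    = e ∷ []
trees (suc n) = e ∷ cartesianProductWith λ⟨_⟩⊕_ (trees n) (trees n)

λ-injective : ∀ {u v u′ v′} → λ⟨ u ⟩⊕ v ≡ λ⟨ u′ ⟩⊕ v′ → u ≡ u′ × v ≡ v′
λ-injective refl = refl , refl

trees-unique : ∀ n → Unique (trees n)
trees-unique zero    = tabulate (λ ()) ∷ []
trees-unique (suc n) =
  tabulate e∉ ∷ Unique.cartesianProductWith⁺ λ⟨_⟩⊕_ λ-injective (trees-unique n) (trees-unique n)
  where
  e∉ : ∀ {t} → t ∈ cartesianProductWith λ⟨_⟩⊕_ (trees n) (trees n) → e ≢ t
  e∉ t∈ refl with ∈-cartesianProductWith⁻ λ⟨_⟩⊕_ (trees n) (trees n) t∈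
  ... | _ , _ , _ , _ , ()

-- The height of a binary tree is at most its number of nodes, which is `size t`.
trees-complete : ∀ n t → size t ≤ n → t ∈ trees n
trees-complete zero    e           _       = here refl
trees-complete (suc n) e           _       = here refl
trees-complete (suc n) (λ⟨ u ⟩⊕ v) (s≤s p) = there (∈-cartesianProductWith⁺ λ⟨_⟩⊕_
  (trees-complete n u (m+n≤o⇒m≤o (size u) p))
  (trees-complete n v (m+n≤o⇒n≤o (size u) p)))

module _ (n : ℕ) (f g : C → ℕ) (a b : ℕ) where

  InFiber : C → Set
  InFiber t = size t ≡ n × f t ≡ a × g t ≡ b

  inFiber? : Decidable InFiber
  inFiber? t = (size t ≟ n) ×-dec (f t ≟ a) ×-dec (g t ≟ b)

  inFiber-irrelevant : Irrelevant InFiber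
  inFiber-irrelevant (p , q , r) (p′ , q′ , r′) =
    cong₂ _,_ (≡-irrelevant p p′) (cong₂ _,_ (≡-irrelevant q q′) (≡-irrelevant r r′))

  fiber-↔ : Fiber n f g a b ↔ Fin (length (filter inFiber? (trees n)))
  fiber-↔ = enumeration-↔ inFiber-irrelevant (filter inFiber? (trees n))
    (Unique.filter⁺ inFiber? (trees-unique n))
    (λ {t} p → ∈-filter⁺ inFiber? (trees-complete n t (≤-reflexive (proj₁ p))) p)
    (λ t∈ → proj₂ (∈-filter⁻ inFiber? {xs = trees n} t∈))

size≥1⇒≢e : ∀ {t} → 1 ≤ size t → t ≢ e
size≥1⇒≢e () refl

internal-h : ∀ t → t ≢ e → internal (h t) ≡ leaves t
internal-h e             t≢e with () ← t≢e refl
internal-h t@(λ⟨ u ⟩⊕ v) _ =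
  trans (sym (leaves-h (h t) (h-≢e u v))) (cong leaves (h-involutive t))

-- The bound on `n` excludes `e`, where `leaves` is 1 but `internal` is 0.
h-fiber-↔ : ∀ n → 1 ≤ n → ∀ a b → Fiber n rpath internal a b ↔ Fiber n sub leaves a b
h-fiber-↔ n 1≤n a b = involution-↔
  (inFiber-irrelevant n rpath internal a b) (inFiber-irrelevant n sub leaves a b)
  h h-involutive
  (λ {t} (s , r , i) →
    trans (size-h t) s , trans (sub-h t) r , trans (leaves-h t (nonempty s)) i)
  (λ {t} (s , r , l) →
    trans (size-h t) s , trans (rpath-h t) r , trans (internal-h t (nonempty s)) l)
  where
  nonempty : ∀ {t} → size t ≡ n → t ≢ e
  nonempty s = size≥1⇒≢e (≤-trans 1≤n (≤-reflexive (sym s)))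

theorem4p1 : ((t : C) → 1 ≤ size t → (rpath (h t) ≡ sub t) × (leaves (h t) ≡ internal t))
    ×
    ((n : ℕ) → 1 ≤ n → SameJointDistribution n sub leaves rpath internal)
theorem4p1 =
  (λ t 1≤t → rpath-h t , leaves-h t (size≥1⇒≢e 1≤t)) ,
  -- The common cardinality is the length of the filtered list for `sub` and `leaves`; the other
  -- fiber inherits it along `h`.
  (λ n 1≤n a b → _ , fiber-↔ n sub leaves a b ,
    (fiber-↔ n sub leaves a b ↔-∘ h-fiber-↔ n 1≤n a b))
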